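{- Let $\mathcal{S}$ be either of the calculi $\mathcal{M}'_{2018}$ or $\mathcal{M}'^{ - }_{2018}$ defined below. Let $\xi,\zeta$ be stoups, $\Pi,\Gamma_1,\Gamma_2$ finite sequences of tree terms, $A,C$ formulae and $\Xi(\cdot)$ a meta-formula context (all in the language of $\mathcal{S}$). If the sequents $\xi;\Pi\to A$ and $\Xi(\zeta;\Gamma_1,A,\Gamma_2)\to C$ are derivable in $\mathcal{S}$, then the sequent $\Xi(\xi,\zeta;\Gamma_1,\Pi,\Gamma_2)\to C$ is also derivable in $\mathcal{S}$.
   Context: Formulae are built from a countable set of variables and the constant $\mathbf{1}$ by the binary connectives $\backslash$, $/$, $\cdot$, $\wedge$, $\vee$ and the unary connectives $\langle\rangle$, $[]^{ -1}$ (bracket modalities) and $!$ (subexponential). A stoup is a finite multiset of formulae ($\varnothing$ is the empty stoup). A tree term is either a formula or an expression $[\Xi]$ with $\Xi$ a meta-formula; a meta-formula is an expression $\zeta;\Gamma$ where $\zeta$ is a stoup and $\Gamma$ is a finite linearly ordered sequence of tree terms (the empty sequence is written $\Lambda$); $\varnothing;\Gamma$ is written simply $\Gamma$. Comma denotes both concatenation of sequences and multiset union of stoups; $\zeta,A$ is $\zeta$ with one more copy of $A$. A sequent is $\Xi\to C$ with $\Xi$ a meta-formula and $C$ a formula. $\Xi(\Theta)$ denotes a meta-formula with a designated occurrence of a meta-formula $\Theta$, which is either $\Xi$ itself or the content of some bracket $[\Theta]$ occurring at any depth in $\Xi$; $\Xi(\Theta')$ is the result of replacing that occurrence by $\Theta'$.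 Below $A,B,C,D,A_1,A_2$ are formulae, $\Gamma,\Delta,\Delta_i,\Gamma_i$ sequences of tree terms, $\zeta,\zeta',\zeta_i$ stoups, $\Xi$ a meta-formula. Common axioms and rules: axioms $A\to A$ and $\Lambda\to\mathbf 1$; ($/L$) from $\zeta_1;\Gamma\to B$ and $\Xi(\zeta_2;\Delta_1,C,\Delta_2)\to D$ infer $\Xi(\zeta_1,\zeta_2;\Delta_1,C/B,\Gamma,\Delta_2)\to D$; ($/R$) from $\zeta;\Gamma,B\to C$ infer $\zeta;\Gamma\to C/B$; ($\backslash L$) from $\zeta_1;\Gamma\to A$ and $\Xi(\zeta_2;\Delta_1,C,\Delta_2)\to D$ infer $\Xi(\zeta_1,\zeta_2;\Delta_1,\Gamma,A\backslash C,\Delta_2)\to D$; ($\backslash R$) from $\zeta;A,\Gamma\to C$ infer $\zeta;\Gamma\to A\backslash C$; ($\cdot L$) from $\Xi(\zeta;\Delta_1,A,B,\Delta_2)\to D$ infer $\Xi(\zeta;\Delta_1,A\cdot B,\Delta_2)\to D$; ($\cdot R$) from $\zeta_1;\Delta\to A$ and $\zeta_2;\Gamma\to B$ infer $\zeta_1,\zeta_2;\Delta,\Gamma\to A\cdot B$; ($\mathbf1 L$) from $\Xi(\zeta;\Delta_1,\Delta_2)\to A$ infer $\Xi(\zeta;\Delta_1,\mathbf1,\Delta_2)\to A$; ($\vee L$) from $\Xi(\zeta;\Delta_1,A_1,\Delta_2)\to C$ and $\Xi(\zeta;\Delta_1,A_2,\Delta_2)\to C$ infer $\Xi(\zeta;\Delta_1,A_1\vee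 A_2,\Delta_2)\to C$; ($\vee R_i$, $i=1,2$) from $\Xi\to A_i$ infer $\Xi\to A_1\vee A_2$; ($\wedge L_i$) from $\Xi(\zeta;\Delta_1,A_i,\Delta_2)\to C$ infer $\Xi(\zeta;\Delta_1,A_1\wedge A_2,\Delta_2)\to C$; ($\wedge R$) from $\Xi\to A_1$ and $\Xi\to A_2$ infer $\Xi\to A_1\wedge A_2$; ($[]^{ -1}L$) from $\Xi(\zeta;\Delta_1,A,\Delta_2)\to B$ infer $\Xi(\zeta;\Delta_1,[[]^{ -1}A],\Delta_2)\to B$; ($[]^{ -1}R$) from $[\Xi]\to A$ infer $\Xi\to []^{ -1}A$; ($\langle\rangle L$) from $\Xi(\zeta;\Delta_1,[A],\Delta_2)\to B$ infer $\Xi(\zeta;\Delta_1,\langle\rangle A,\Delta_2)\to B$; ($\langle\rangle R$) from $\Xi\to A$ infer $[\Xi]\to\langle\rangle A$; ($!L$) from $\Xi(\zeta,A;\Gamma_1,\Gamma_2)\to B$ infer $\Xi(\zeta;\Gamma_1,!A,\Gamma_2)\to B$; ($!P$) from $\Xi(\zeta;\Gamma_1,A,\Gamma_2)\to B$ infer $\Xi(\zeta,A;\Gamma_1,\Gamma_2)\to B$. The calculus $\mathcal{M}'_{2018}$ consists of the common axioms and rules together with ($!R'$) from $A;\Lambda\to B$ infer $A;\Lambda\to !B$ (the stoup consists of exactly one formula) and ($!C'$) from $\Xi(\zeta,A;\Gamma_1,[\zeta',A;\Gamma_2],\Gamma_3)\to B$ infer $\Xi(\zeta,A;\Gamma_1,[[\zeta';\Gamma_2]],\Gamma_3)\to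 B$. The calculus $\mathcal{M}'^{ - }_{2018}$ (with Lambek's non-emptiness restriction) is $\mathcal{M}'_{2018}$ restricted to formulae not containing $\mathbf1$, without the axiom $\Lambda\to\mathbf1$ and the rule $\mathbf1L$, and with the side conditions: $\backslash R$ and $/R$ may be applied only if $\Gamma\neq\Lambda$ or $\zeta\neq\varnothing$; $!C'$ may be applied only if $\Gamma_2\neq\Lambda$ or $\zeta'\neq\varnothing$. Cut is not a rule of these calculi; "derivable" means derivable by the listed axioms and rules. -}

module Defs where

open import Data.List.Base using (List; []; _∷_; _++_)
open import Data.List.Relation.Binary.Permutation.Propositional using (_↭_)
open import Data.Nat.Base using (ℕ)
open import Data.Sum.Base using (_⊎_)
open import Data.Unit.Base using (⊤)
open import Relation.Binary.PropositionalEquality.Core using (_≢_)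

-- M′₂₀₁₈⁻ is the calculus with Lambek's non-emptiness restriction.
data Calculus : Set where
  M′₂₀₁₈ M′₂₀₁₈⁻ : Calculus

infix  20 !_ ⟨⟩_ []⁻¹_
infixl 15 _·_
infixr 14 _⧹_
infixl 14 _/_
infixl 13 _∧_
infixl 12 _∨_

-- Formulae in the language of a calculus: the constant 𝟏 is absent from
-- the language of M′₂₀₁₈⁻.
data Formula : Calculus → Set where
  var              : ∀ {S} → ℕ → Formula S
  𝟏                : Formula M′₂₀₁₈
  _⧹_ _/_ _·_ _∧_ _∨_ : ∀ {S} → Formula S → Formula S → Formula S
  ⟨⟩_ []⁻¹_ !_     : ∀ {S} → Formula S → Formula S

-- Stoups are finite multisets: lists taken up to permutation. The
-- identification of permuted stoups, at any bracket depth, is imposed on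
-- sequents by the rule `perm` below.
Stoup : Calculus → Set
Stoup S = List (Formula S)

infix 4 _⨾_

mutual
  data TreeTerm (S : Calculus) : Set where
    fm  : Formula S → TreeTerm S
    [_] : MetaFormula S → TreeTerm S

  data MetaFormula (S : Calculus) : Set where
    _⨾_ : Stoup S → List (TreeTerm S) → MetaFormula S

Sequence : Calculus → Set
Sequence S = List (TreeTerm S)

-- Ξ(·). The designated occurrence is the whole meta-formula, or lies inside
-- some bracket of the sequence: `within ζ Γ Ξ Δ` is  ζ ; Γ , [ Ξ(·) ] , Δ.
data Context (S : Calculus) : Set where
  ∙      : Context S
  within : Stoup S → Sequence S → Context S → Sequence S → Context S

infix 5 _⟪_⟫

_⟪_⟫ : ∀ {S} → Context S → MetaFormula S → MetaFormula S
∙              ⟪ Θ ⟫ = Θ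
within ζ Γ Ξ Δ ⟪ Θ ⟫ = ζ ⨾ Γ ++ [ Ξ ⟪ Θ ⟫ ] ∷ Δ

NonEmptyIfRestricted : (S : Calculus) → Stoup S → Sequence S → Set
NonEmptyIfRestricted M′₂₀₁₈  ζ Γ = ⊤
NonEmptyIfRestricted M′₂₀₁₈⁻ ζ Γ = Γ ≢ [] ⊎ ζ ≢ []

private variable
  S                    : Calculus
  A B C D A₁ A₂        : Formula S
  ζ ζ′ ζ₁ ζ₂           : Stoup S
  Γ Γ₁ Γ₂ Γ₃ Δ Δ₁ Δ₂   : Sequence S
  Θ                    : MetaFormula S

infix 3 _⊢_

-- Derivability of the sequent Θ → C in the calculus S. The argument Ξ of a
-- left rule is the surrounding context.
data _⊢_ : {S : Calculus} → MetaFormula S → Formula S → Set where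

  perm : (Ξ : Context S) → ζ ↭ ζ′ →
         Ξ ⟪ ζ ⨾ Γ ⟫ ⊢ C →
         Ξ ⟪ ζ′ ⨾ Γ ⟫ ⊢ C

  ax   : [] ⨾ fm A ∷ [] ⊢ A

  𝟏R   : [] ⨾ [] ⊢ 𝟏

  𝟏L   : (Ξ : Context M′₂₀₁₈) →
         Ξ ⟪ ζ ⨾ Δ₁ ++ Δ₂ ⟫ ⊢ A →
         Ξ ⟪ ζ ⨾ Δ₁ ++ fm 𝟏 ∷ Δ₂ ⟫ ⊢ A

  /L   : (Ξ : Context S) →
         ζ₁ ⨾ Γ ⊢ B →
         Ξ ⟪ ζ₂ ⨾ Δ₁ ++ fm C ∷ Δ₂ ⟫ ⊢ D →
         Ξ ⟪ ζ₁ ++ ζ₂ ⨾ Δ₁ ++ fm (C / B) ∷ Γ ++ Δ₂ ⟫ ⊢ D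

  /R   : NonEmptyIfRestricted S ζ Γ →
         ζ ⨾ Γ ++ fm B ∷ [] ⊢ C →
         ζ ⨾ Γ ⊢ C / B

  ⧹L   : (Ξ : Context S) →
         ζ₁ ⨾ Γ ⊢ A →
         Ξ ⟪ ζ₂ ⨾ Δ₁ ++ fm C ∷ Δ₂ ⟫ ⊢ D →
         Ξ ⟪ ζ₁ ++ ζ₂ ⨾ Δ₁ ++ Γ ++ fm (A ⧹ C) ∷ Δ₂ ⟫ ⊢ D

  ⧹R   : NonEmptyIfRestricted S ζ Γ →
         ζ ⨾ fm A ∷ Γ ⊢ C →
         ζ ⨾ Γ ⊢ A ⧹ C

  ·L   : (Ξ : Context S) →
         Ξ ⟪ ζ ⨾ Δ₁ ++ fm A ∷ fm B ∷ Δ₂ ⟫ ⊢ D →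
         Ξ ⟪ ζ ⨾ Δ₁ ++ fm (A · B) ∷ Δ₂ ⟫ ⊢ D

  ·R   : ζ₁ ⨾ Δ ⊢ A →
         ζ₂ ⨾ Γ ⊢ B →
         ζ₁ ++ ζ₂ ⨾ Δ ++ Γ ⊢ A · B

  ∨L   : (Ξ : Context S) →
         Ξ ⟪ ζ ⨾ Δ₁ ++ fm A₁ ∷ Δ₂ ⟫ ⊢ C →
         Ξ ⟪ ζ ⨾ Δ₁ ++ fm A₂ ∷ Δ₂ ⟫ ⊢ C →
         Ξ ⟪ ζ ⨾ Δ₁ ++ fm (A₁ ∨ A₂) ∷ Δ₂ ⟫ ⊢ C

  ∨R₁  : Θ ⊢ A₁ →
         Θ ⊢ A₁ ∨ A₂

  ∨R₂  : Θ ⊢ A₂ →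
         Θ ⊢ A₁ ∨ A₂

  ∧L₁  : (Ξ : Context S) →
         Ξ ⟪ ζ ⨾ Δ₁ ++ fm A₁ ∷ Δ₂ ⟫ ⊢ C →
         Ξ ⟪ ζ ⨾ Δ₁ ++ fm (A₁ ∧ A₂) ∷ Δ₂ ⟫ ⊢ C

  ∧L₂  : (Ξ : Context S) →
         Ξ ⟪ ζ ⨾ Δ₁ ++ fm A₂ ∷ Δ₂ ⟫ ⊢ C →
         Ξ ⟪ ζ ⨾ Δ₁ ++ fm (A₁ ∧ A₂) ∷ Δ₂ ⟫ ⊢ C

  ∧R   : Θ ⊢ A₁ →
         Θ ⊢ A₂ →
         Θ ⊢ A₁ ∧ A₂

  []⁻¹L : (Ξ : Context S) →
         Ξ ⟪ ζ ⨾ Δ₁ ++ fm A ∷ Δ₂ ⟫ ⊢ B →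
         Ξ ⟪ ζ ⨾ Δ₁ ++ [ [] ⨾ fm ([]⁻¹ A) ∷ [] ] ∷ Δ₂ ⟫ ⊢ B

  []⁻¹R : [] ⨾ [ Θ ] ∷ [] ⊢ A →
         Θ ⊢ []⁻¹ A

  ⟨⟩L  : (Ξ : Context S) →
         Ξ ⟪ ζ ⨾ Δ₁ ++ [ [] ⨾ fm A ∷ [] ] ∷ Δ₂ ⟫ ⊢ B →
         Ξ ⟪ ζ ⨾ Δ₁ ++ fm (⟨⟩ A) ∷ Δ₂ ⟫ ⊢ B

  ⟨⟩R  : Θ ⊢ A →
         [] ⨾ [ Θ ] ∷ [] ⊢ ⟨⟩ A

  !L   : (Ξ : Context S) →
         Ξ ⟪ A ∷ ζ ⨾ Γ₁ ++ Γ₂ ⟫ ⊢ B →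
         Ξ ⟪ ζ ⨾ Γ₁ ++ fm (! A) ∷ Γ₂ ⟫ ⊢ B

  !P   : (Ξ : Context S) →
         Ξ ⟪ ζ ⨾ Γ₁ ++ fm A ∷ Γ₂ ⟫ ⊢ B →
         Ξ ⟪ A ∷ ζ ⨾ Γ₁ ++ Γ₂ ⟫ ⊢ B

  !R′  : A ∷ [] ⨾ [] ⊢ B →
         A ∷ [] ⨾ [] ⊢ ! B

  !C′  : (Ξ : Context S) → NonEmptyIfRestricted S ζ′ Γ₂ →
         Ξ ⟪ A ∷ ζ ⨾ Γ₁ ++ [ A ∷ ζ′ ⨾ Γ₂ ] ∷ Γ₃ ⟫ ⊢ B →
         Ξ ⟪ A ∷ ζ ⨾ Γ₁ ++ [ [] ⨾ [ ζ′ ⨾ Γ₂ ] ∷ [] ] ∷ Γ₃ ⟫ ⊢ B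

{-# OPTIONS --safe #-}
module Submission where

-- Semantic (phase-space) cut elimination. Every formula A denotes a set ⟦ A ⟧ of
-- meta-formulae, closed under the closure operator induced by derivability in
-- contexts, with A ∈ ⟦ A ⟧ ⊆ { Θ ∣ Θ ⊢ A }. Cut-free derivations are sound for this
-- semantics in a strong form: if Θ ⊢ C and Θ′ arises from Θ by replacing each formula
-- occurrence B of a sequence by an element of ⟦ B ⟧ (and each B of a stoup by some B′
-- with B′ ⨾ Λ in ⟦ B ⟧), then Θ′ ∈ ⟦ C ⟧. Soundness of the left premise of a cut puts
-- ξ ⨾ Π into ⟦ A ⟧; soundness of the right premise then lets it replace A.

open import Defs
open import Data.Empty using (⊥-elim)
open import Data.List.Base using ([]; _∷_; _++_)
open import Data.List.Properties using (++-assoc; ++-identityʳ)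
open import Data.List.Relation.Binary.Permutation.Propositional
  using (_↭_; prep; swap; ↭-refl; ↭-sym; ↭-trans; ↭-reflexive; module PermutationReasoning)
import Data.List.Relation.Binary.Permutation.Propositional as Perm
open import Data.List.Relation.Binary.Permutation.Propositional.Properties
  using (↭-empty-inv; ++⁺ˡ; ++⁺ʳ; ++-comm; shifts)
open import Data.List.Relation.Unary.All using (All; []; _∷_)
import Data.List.Relation.Unary.All.Properties as All
open import Data.List.Relation.Binary.Pointwise using (Pointwise; []; _∷_)
import Data.List.Relation.Binary.Pointwise as Pointwise
open import Data.Product.Base using (∃; _×_; _,_; proj₁; proj₂)
open import Data.Sum.Base using (_⊎_; inj₁; inj₂)
open import Data.Unit.Base using (tt)
open import Function.Base using (id; _∘_)
open import Relation.Binary.PropositionalEquality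
  using (_≡_; _≢_; refl; sym; trans; cong; cong₂; subst)

private variable
  S                : Calculus
  A B C            : Formula S
  ζ ζ′ ζ₁ ζ₂       : Stoup S
  Γ Γ′ Γ₁ Γ₂ Δ     : Sequence S
  Θ Θ′ Φ Φ′ Ψ Ψ′   : MetaFormula S

-- The monoid of meta-formulae

Pred : Calculus → Set₁
Pred S = MetaFormula S → Set

infixr 6 _⊗_

ε : MetaFormula S
ε = [] ⨾ []

_⊗_ : MetaFormula S → MetaFormula S → MetaFormula S
(ζ₁ ⨾ Γ₁) ⊗ (ζ₂ ⨾ Γ₂) = ζ₁ ++ ζ₂ ⨾ Γ₁ ++ Γ₂

formula : Formula S → MetaFormula S
formula A = [] ⨾ fm A ∷ []

stouped : Formula S → MetaFormula S
stouped A = A ∷ [] ⨾ []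

bracket : MetaFormula S → MetaFormula S
bracket Θ = [] ⨾ [ Θ ] ∷ []

⊗-identityʳ : (Φ : MetaFormula S) → Φ ⊗ ε ≡ Φ
⊗-identityʳ (ζ ⨾ Γ) = cong₂ _⨾_ (++-identityʳ ζ) (++-identityʳ Γ)

⊗-identityˡ : (Φ : MetaFormula S) → ε ⊗ Φ ≡ Φ
⊗-identityˡ (ζ ⨾ Γ) = refl

⊗-assoc : (Φ Ψ Θ : MetaFormula S) → (Φ ⊗ Ψ) ⊗ Θ ≡ Φ ⊗ (Ψ ⊗ Θ)
⊗-assoc (ζ₁ ⨾ Γ₁) (ζ₂ ⨾ Γ₂) (ζ₃ ⨾ Γ₃) =
  cong₂ _⨾_ (++-assoc ζ₁ ζ₂ ζ₃) (++-assoc Γ₁ Γ₂ Γ₃)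

-- Contexts and slots

_⟪⟪_⟫⟫ : Context S → Context S → Context S
∙              ⟪⟪ Ω ⟫⟫ = Ω
within ζ Γ Ξ Δ ⟪⟪ Ω ⟫⟫ = within ζ Γ (Ξ ⟪⟪ Ω ⟫⟫) Δ

⟪⟪⟫⟫-⟪⟫ : (Ξ Ω : Context S) (Θ : MetaFormula S) → Ξ ⟪⟪ Ω ⟫⟫ ⟪ Θ ⟫ ≡ Ξ ⟪ Ω ⟪ Θ ⟫ ⟫
⟪⟪⟫⟫-⟪⟫ ∙                Ω Θ = refl
⟪⟪⟫⟫-⟪⟫ (within ζ Γ Ξ Δ) Ω Θ = cong (λ Φ → ζ ⨾ Γ ++ [ Φ ] ∷ Δ) (⟪⟪⟫⟫-⟪⟫ Ξ Ω Θ)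

-- Left rules act on a segment of a sequence, whereas a `Context` exchanges the whole content of a
-- bracket. Filling a slot splices the filler in, its stoup joining the surrounding one.
data Slot (S : Calculus) : Set where
  slot : Context S → Stoup S → Sequence S → Sequence S → Slot S

insert : Stoup S → Sequence S → Sequence S → MetaFormula S → MetaFormula S
insert ζ Γ₁ Γ₂ (ξ ⨾ Π) = ξ ++ ζ ⨾ Γ₁ ++ Π ++ Γ₂

plug : Slot S → MetaFormula S → MetaFormula S
plug (slot Ξ ζ Γ₁ Γ₂) Φ = Ξ ⟪ insert ζ Γ₁ Γ₂ Φ ⟫

permute : (Ξ : Context S) → ζ ↭ ζ′ → Γ ≡ Γ′ → Ξ ⟪ ζ ⨾ Γ ⟫ ⊢ C → Ξ ⟪ ζ′ ⨾ Γ′ ⟫ ⊢ C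
permute Ξ p refl d = perm Ξ p d

-- The derivability preorder and its closure operator

infix 4 _⊑_

-- The order runs from premise to conclusion, so single-premise left rules are instances of it.
record _⊑_ {S} (Φ Ψ : MetaFormula S) : Set where
  constructor mk⊑
  field transport : ∀ K {C} → plug K Φ ⊢ C → plug K Ψ ⊢ C
open _⊑_

⊑-refl : Φ ⊑ Φ
⊑-refl = mk⊑ λ K d → d

⊑-trans : Φ ⊑ Ψ → Ψ ⊑ Θ → Φ ⊑ Θ
⊑-trans p q = mk⊑ λ K d → transport q K (transport p K d)

↭⇒⊑ : ζ ↭ ζ′ → (ζ ⨾ Γ) ⊑ (ζ′ ⨾ Γ)
↭⇒⊑ p = mk⊑ λ { (slot Ξ ζ Γ₁ Γ₂) → perm Ξ (++⁺ʳ ζ p) }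

stoup-shift : (ζ : Stoup S) (Φ Ψ : MetaFormula S) →
              ((ζ ⨾ []) ⊗ Φ ⊗ Ψ) ⊑ (Φ ⊗ (ζ ⨾ []) ⊗ Ψ)
stoup-shift ζ (φ ⨾ _) (ψ ⨾ _) = ↭⇒⊑ (shifts ζ φ)

stoup-unshift : (ζ : Stoup S) (Φ Ψ : MetaFormula S) →
                (Φ ⊗ (ζ ⨾ []) ⊗ Ψ) ⊑ ((ζ ⨾ []) ⊗ Φ ⊗ Ψ)
stoup-unshift ζ (φ ⨾ _) (ψ ⨾ _) = ↭⇒⊑ (shifts φ ζ)

-- The biorthogonal closure for the pairing of meta-formulae with tests: a test is a slot `K` with a
-- succedent `C`, passed by `Φ` when `plug K Φ ⊢ C`.
record Cl {S} (X : Pred S) (Θ : MetaFormula S) : Set where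
  constructor mkCl
  field derive : ∀ K {C} → (∀ {Φ} → X Φ → plug K Φ ⊢ C) → plug K Θ ⊢ C
open Cl

Closed : Pred S → Set
Closed X = ∀ {Θ} → Cl X Θ → X Θ

private variable
  X Y : Pred S

η : X Θ → Cl X Θ
η x = mkCl λ K h → h x

Cl-bind : (∀ {Φ} → X Φ → Cl Y Φ) → Cl X Θ → Cl Y Θ
Cl-bind f c = mkCl λ K h → derive c K λ x → derive (f x) K h

Cl-closed : Closed (Cl X)
Cl-closed = Cl-bind id

Closed-⊑ : Closed X → Φ ⊑ Ψ → X Φ → X Ψ
Closed-⊑ cl p x = cl (mkCl λ K h → transport p K (h x))

-- This set is cut out by a single test, the empty slot with succedent `C`.
⊢-closed : {C : Formula S} → Closed (_⊢ C)
⊢-closed {Θ = Θ} c =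
  subst (_⊢ _) (whole Θ) (derive c (slot ∙ [] [] []) λ {Φ} d → subst (_⊢ _) (sym (whole Φ)) d)
  where
  whole : (Φ : MetaFormula S) → plug (slot ∙ [] [] []) Φ ≡ Φ
  whole (ζ ⨾ Γ) = ⊗-identityʳ (ζ ⨾ Γ)

Cl⊆⊢ : (∀ {Φ} → X Φ → Φ ⊢ C) → Cl X Θ → Θ ⊢ C
Cl⊆⊢ f c = ⊢-closed (Cl-bind (η ∘ f) c)

-- Frames

-- `residual K` plays the composite of `K` with `f`. Agreement is asked only up to derivability,
-- since the two may order stoups differently.
record Framelike {S} (f : MetaFormula S → MetaFormula S) : Set where
  field
    residual : Slot S → Slot S
    to       : ∀ K Φ {C} → plug K (f Φ) ⊢ C → plug (residual K) Φ ⊢ C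
    from     : ∀ K Φ {C} → plug (residual K) Φ ⊢ C → plug K (f Φ) ⊢ C
open Framelike

private variable
  f g p q : MetaFormula S → MetaFormula S

Framelike-∘ : Framelike f → Framelike g → Framelike (f ∘ g)
Framelike-∘ {g = g} F G = record
  { residual = residual G ∘ residual F
  ; to       = λ K Φ → to G (residual F K) Φ ∘ to F K (g Φ)
  ; from     = λ K Φ → from F K (g Φ) ∘ from G (residual F K) Φ
  }

Framelike-id : Framelike {S} id
Framelike-id = record { residual = id ; to = λ K Φ → id ; from = λ K Φ → id }

Framelike-⊗ˡ : (Θ : MetaFormula S) → Framelike (Θ ⊗_)
Framelike-⊗ˡ {S} (θ ⨾ T) = record
  { residual = λ { (slot Ξ ζ Γ₁ Γ₂) → slot Ξ (θ ++ ζ) (Γ₁ ++ T) Γ₂ }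
  ; to       = λ { (slot Ξ ζ Γ₁ Γ₂) (ξ ⨾ Π) → permute Ξ (stoups ξ ζ) (sequences Γ₁ Π Γ₂) }
  ; from     = λ { (slot Ξ ζ Γ₁ Γ₂) (ξ ⨾ Π) →
                   permute Ξ (↭-sym (stoups ξ ζ)) (sym (sequences Γ₁ Π Γ₂)) }
  }
  where
  stoups : ∀ ξ ζ → (θ ++ ξ) ++ ζ ↭ ξ ++ (θ ++ ζ)
  stoups ξ ζ = ↭-trans (↭-reflexive (++-assoc θ ξ ζ)) (shifts θ ξ)
  sequences : ∀ Γ₁ Π Γ₂ → Γ₁ ++ (T ++ Π) ++ Γ₂ ≡ (Γ₁ ++ T) ++ Π ++ Γ₂
  sequences Γ₁ Π Γ₂ = trans (cong (Γ₁ ++_) (++-assoc T Π Γ₂)) (sym (++-assoc Γ₁ T (Π ++ Γ₂)))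

Framelike-⊗ʳ : (Θ : MetaFormula S) → Framelike (_⊗ Θ)
Framelike-⊗ʳ (θ ⨾ T) = record
  { residual = λ { (slot Ξ ζ Γ₁ Γ₂) → slot Ξ (θ ++ ζ) Γ₁ (T ++ Γ₂) }
  ; to       = λ { (slot Ξ ζ Γ₁ Γ₂) (ξ ⨾ Π) →
                   permute Ξ (↭-reflexive (++-assoc ξ θ ζ)) (cong (Γ₁ ++_) (++-assoc Π T Γ₂)) }
  ; from     = λ { (slot Ξ ζ Γ₁ Γ₂) (ξ ⨾ Π) →
                   permute Ξ (↭-reflexive (sym (++-assoc ξ θ ζ)))
                             (cong (Γ₁ ++_) (sym (++-assoc Π T Γ₂))) }
  }

Framelike-bracket : Framelike {S} bracket
Framelike-bracket {S} = record
  { residual = λ { (slot Ξ ζ Γ₁ Γ₂) → slot (Ξ ⟪⟪ within ζ Γ₁ ∙ Γ₂ ⟫⟫) [] [] [] }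
  ; to       = λ { (slot Ξ ζ Γ₁ Γ₂) Φ → subst (_⊢ _) (eq Ξ ζ Γ₁ Γ₂ Φ) }
  ; from     = λ { (slot Ξ ζ Γ₁ Γ₂) Φ → subst (_⊢ _) (sym (eq Ξ ζ Γ₁ Γ₂ Φ)) }
  }
  where
  eq : ∀ Ξ ζ Γ₁ Γ₂ (Φ : MetaFormula S) →
       Ξ ⟪ ζ ⨾ Γ₁ ++ [ Φ ] ∷ Γ₂ ⟫ ≡ plug (slot (Ξ ⟪⟪ within ζ Γ₁ ∙ Γ₂ ⟫⟫) [] [] []) Φ
  eq Ξ ζ Γ₁ Γ₂ (ξ ⨾ Π) =
    trans (sym (⟪⟪⟫⟫-⟪⟫ Ξ (within ζ Γ₁ ∙ Γ₂) (ξ ⨾ Π)))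
          (cong ((Ξ ⟪⟪ within ζ Γ₁ ∙ Γ₂ ⟫⟫) ⟪_⟫) (sym (⊗-identityʳ (ξ ⨾ Π))))

Framelike-mono : Framelike f → Φ ⊑ Ψ → f Φ ⊑ f Ψ
Framelike-mono F p = mk⊑ λ K → from F K _ ∘ transport p (residual F K) ∘ to F K _

-- Testing `f Θ` in `K` amounts to testing `Θ` in `residual K`. This is the nucleus property of the
-- closure.
Cl-frame : Framelike f → (∀ {Φ} → X Φ → Cl Y (f Φ)) → Cl X Θ → Cl Y (f Θ)
Cl-frame F h c = mkCl λ K k → from F K _ (derive c (residual F K) λ {Φ} x → to F K Φ (derive (h x) K k))

-- Denotations

data _⊗ᴾ_ {S} (X Y : Pred S) : Pred S where
  _,_ : X Φ → Y Ψ → (X ⊗ᴾ Y) (Φ ⊗ Ψ)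

data Bracketᴾ {S} (X : Pred S) : Pred S where
  bracketᴾ : X Φ → Bracketᴾ X (bracket Φ)

-- The generators for `!` are exactly the antecedents that `!R′` admits: one stoup formula and an
-- empty sequence.
data Stoupedᴾ {S} (X : Pred S) : Pred S where
  stoupedᴾ : X (stouped A) → Stoupedᴾ X (stouped A)

-- The conjunct Θ ⊢ A in the implications secures Lambek's restriction, which is not
-- stable under Cl.
⟦_⟧ : Formula S → Pred S
⟦ var n ⟧ Θ = Θ ⊢ var n
⟦ 𝟏 ⟧       = Cl (_≡ ε)
⟦ A ⧹ C ⟧ Θ = Θ ⊢ A ⧹ C × (∀ {Φ} → ⟦ A ⟧ Φ → ⟦ C ⟧ (Φ ⊗ Θ))
⟦ C / B ⟧ Θ = Θ ⊢ C / B × (∀ {Φ} → ⟦ B ⟧ Φ → ⟦ C ⟧ (Θ ⊗ Φ))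
⟦ A · B ⟧   = Cl (⟦ A ⟧ ⊗ᴾ ⟦ B ⟧)
⟦ A ∧ B ⟧ Θ = ⟦ A ⟧ Θ × ⟦ B ⟧ Θ
⟦ A ∨ B ⟧   = Cl (λ Φ → ⟦ A ⟧ Φ ⊎ ⟦ B ⟧ Φ)
⟦ ⟨⟩ A ⟧    = Cl (Bracketᴾ ⟦ A ⟧)
⟦ []⁻¹ A ⟧ Θ = ⟦ A ⟧ (bracket Θ)
⟦ ! A ⟧     = Cl (Stoupedᴾ ⟦ A ⟧)

-- Positive connectives denote closures outright; the others are intersections and preimages of
-- closed sets under frames.
⟦⟧-closed : (A : Formula S) → Closed ⟦ A ⟧
⟦⟧-closed (var n)  = ⊢-closed
⟦⟧-closed 𝟏        = Cl-closed
⟦⟧-closed (A ⧹ C) c =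
  Cl⊆⊢ proj₁ c , λ {Φ} a → ⟦⟧-closed C (Cl-frame (Framelike-⊗ˡ Φ) (λ x → η (proj₂ x a)) c)
⟦⟧-closed (C / B) c =
  Cl⊆⊢ proj₁ c , λ {Φ} b → ⟦⟧-closed C (Cl-frame (Framelike-⊗ʳ Φ) (λ x → η (proj₂ x b)) c)
⟦⟧-closed (A · B)  = Cl-closed
⟦⟧-closed (A ∧ B) c = ⟦⟧-closed A (Cl-bind (η ∘ proj₁) c) , ⟦⟧-closed B (Cl-bind (η ∘ proj₂) c)
⟦⟧-closed (A ∨ B)  = Cl-closed
⟦⟧-closed (⟨⟩ A)   = Cl-closed
⟦⟧-closed ([]⁻¹ A) c = ⟦⟧-closed A (Cl-frame Framelike-bracket η c)
⟦⟧-closed (! A)    = Cl-closed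

⟦⟧-⊑ : (A : Formula S) → Φ ⊑ Ψ → ⟦ A ⟧ Φ → ⟦ A ⟧ Ψ
⟦⟧-⊑ A = Closed-⊑ (⟦⟧-closed A)

!P-⊑ : formula A ⊑ stouped A
!P-⊑ = mk⊑ λ { (slot Ξ ζ Γ₁ Γ₂) → !P Ξ }

mutual
  -- For a positive connective the right rule treats the generators, and `Cl⊆⊢` extends this to
  -- their closure.
  reify : (A : Formula S) → ⟦ A ⟧ Θ → Θ ⊢ A
  reify (var n)  d = d
  reify 𝟏        c = Cl⊆⊢ (λ { refl → 𝟏R }) c
  reify (A ⧹ C)  x = proj₁ x
  reify (C / B)  x = proj₁ x
  reify (A · B)  c = Cl⊆⊢ (λ { (_,_ {Φ = _ ⨾ _} {Ψ = _ ⨾ _} a b) → ·R (reify A a) (reify B b) }) c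
  reify (A ∧ B)  (a , b) = ∧R (reify A a) (reify B b)
  reify (A ∨ B)  c = Cl⊆⊢ (λ { (inj₁ a) → ∨R₁ (reify A a) ; (inj₂ b) → ∨R₂ (reify B b) }) c
  reify (⟨⟩ A)   c = Cl⊆⊢ (λ { (bracketᴾ a) → ⟨⟩R (reify A a) }) c
  reify ([]⁻¹ A) a = []⁻¹R (reify A a)
  reify (! A)    c = Cl⊆⊢ (λ { (stoupedᴾ a) → !R′ (reify A a) }) c

  -- Each case is a left rule read as a closure or `⊑` step. The implications call `reify` on the
  -- argument to obtain the minor premise.
  reflect : (A : Formula S) → ⟦ A ⟧ (formula A)
  reflect (var n)  = ax
  reflect 𝟏        = mkCl λ { (slot Ξ ζ Γ₁ Γ₂) h → 𝟏L Ξ (h refl) }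
  reflect (A ⧹ C)  = ax , λ { {ζ ⨾ Γ} a → ⟦⟧-⊑ C (mk⊑ (λ
    { (slot Ξ ξ Γ₁ Γ₂) d →
      permute Ξ (↭-reflexive (cong (_++ ξ) (sym (++-identityʳ ζ))))
                (cong (Γ₁ ++_) (sym (++-assoc Γ (fm (A ⧹ C) ∷ []) Γ₂)))
        (⧹L Ξ (reify A a) d) })) (reflect C) }
  reflect (C / B)  = ax , λ { {ζ ⨾ Γ} b → ⟦⟧-⊑ C (mk⊑ (λ
    { (slot Ξ ξ Γ₁ Γ₂) d → /L Ξ (reify B b) d })) (reflect C) }
  reflect (A · B)  = mkCl λ { (slot Ξ ζ Γ₁ Γ₂) h → ·L Ξ (h (reflect A , reflect B)) }
  reflect (A ∧ B)  =
    ⟦⟧-⊑ A (mk⊑ λ { (slot Ξ ζ Γ₁ Γ₂) → ∧L₁ Ξ }) (reflect A) ,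
    ⟦⟧-⊑ B (mk⊑ λ { (slot Ξ ζ Γ₁ Γ₂) → ∧L₂ Ξ }) (reflect B)
  reflect (A ∨ B)  =
    mkCl λ { (slot Ξ ζ Γ₁ Γ₂) h → ∨L Ξ (h (inj₁ (reflect A))) (h (inj₂ (reflect B))) }
  reflect (⟨⟩ A)   = mkCl λ { (slot Ξ ζ Γ₁ Γ₂) h → ⟨⟩L Ξ (h (bracketᴾ (reflect A))) }
  reflect ([]⁻¹ A) = ⟦⟧-⊑ A (mk⊑ λ { (slot Ξ ζ Γ₁ Γ₂) → []⁻¹L Ξ }) (reflect A)
  reflect (! A)    =
    mkCl λ { (slot Ξ ζ Γ₁ Γ₂) h → !L Ξ (h (stoupedᴾ (⟦⟧-⊑ A !P-⊑ (reflect A)))) }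

-- Substitution instances

-- A stoup formula is replaced by a single formula, not by an arbitrary meta-formula: `!R′` requires
-- a one-formula stoup and `!C′` copies one formula.
_◂ˢ_ : Stoup S → Stoup S → Set
_◂ˢ_ = Pointwise (λ A A′ → ⟦ A ⟧ (stouped A′))

infix 3 _◂ˢ_ _◂_ _◂ᵐ_

mutual
  -- Stoups brought in by replacements float out to the enclosing bracket, which is why the index is
  -- a meta-formula rather than a sequence.
  data _◂_ {S} : Sequence S → Pred S where
    []   : [] ◂ ε
    fm   : ⟦ A ⟧ Φ → Γ ◂ Ψ → fm A ∷ Γ ◂ Φ ⊗ Ψ
    [_]∷_ : Θ ◂ᵐ Φ → Γ ◂ Ψ → [ Θ ] ∷ Γ ◂ bracket Φ ⊗ Ψ

  data _◂ᵐ_ {S} : MetaFormula S → Pred S where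
    _⨾_ : ζ ◂ˢ ζ′ → Γ ◂ Ψ → ζ ⨾ Γ ◂ᵐ (ζ′ ⨾ []) ⊗ Ψ

◂-++⁺ : Γ₁ ◂ Φ → Γ₂ ◂ Ψ → Γ₁ ++ Γ₂ ◂ Φ ⊗ Ψ
◂-++⁺ {Ψ = Ψ} [] n = subst (_ ◂_) (sym (⊗-identityˡ Ψ)) n
◂-++⁺ (fm {Φ = Φ} {Ψ = Φ′} a m) n = subst (_ ◂_) (sym (⊗-assoc Φ Φ′ _)) (fm a (◂-++⁺ m n))
◂-++⁺ ([_]∷_ {Φ = Φ} {Ψ = Φ′} b m) n =
  subst (_ ◂_) (sym (⊗-assoc (bracket Φ) Φ′ _)) ([ b ]∷ ◂-++⁺ m n)

data Split {S} (Γ₁ Γ₂ : Sequence S) : Pred S where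
  split : Γ₁ ◂ Φ → Γ₂ ◂ Ψ → Split Γ₁ Γ₂ (Φ ⊗ Ψ)

◂-++⁻ : ∀ (Γ₁ : Sequence S) {Γ₂} → Γ₁ ++ Γ₂ ◂ Θ → Split Γ₁ Γ₂ Θ
◂-++⁻ [] m = subst (Split _ _) (⊗-identityˡ _) (split [] m)
◂-++⁻ (fm A ∷ Γ₁) (fm {Φ = Φ} a m) with ◂-++⁻ Γ₁ m
... | split {Φ = Φ₁} {Ψ = Φ₂} m₁ m₂ =
  subst (Split _ _) (⊗-assoc Φ Φ₁ Φ₂) (split (fm a m₁) m₂)
◂-++⁻ ([ Θ ] ∷ Γ₁) ([_]∷_ {Φ = Φ} b m) with ◂-++⁻ Γ₁ m
... | split {Φ = Φ₁} {Ψ = Φ₂} m₁ m₂ =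
  subst (Split _ _) (⊗-assoc (bracket Φ) Φ₁ Φ₂) (split ([ b ]∷ m₁) m₂)

data SplitStoup {S} (ζ₁ ζ₂ : Stoup S) : Stoup S → Set where
  split : ∀ {ξ₁ ξ₂} → ζ₁ ◂ˢ ξ₁ → ζ₂ ◂ˢ ξ₂ → SplitStoup ζ₁ ζ₂ (ξ₁ ++ ξ₂)

◂ˢ-++⁻ : ∀ (ζ₁ : Stoup S) {ζ₂ ξ} → ζ₁ ++ ζ₂ ◂ˢ ξ → SplitStoup ζ₁ ζ₂ ξ
◂ˢ-++⁻ []       ms = split [] ms
◂ˢ-++⁻ (A ∷ ζ₁) (m ∷ ms) with ◂ˢ-++⁻ ζ₁ ms
... | split ms₁ ms₂ = split (m ∷ ms₁) ms₂

-- Soundness of `perm` starts from an instance of the conclusion, so the permutation is traced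
-- backwards to an instance of the premise.
◂ˢ-↭ : ∀ {ζ ζ′ ξ′ : Stoup S} → ζ ↭ ζ′ → ζ′ ◂ˢ ξ′ → ∃ λ ξ → ζ ◂ˢ ξ × ξ ↭ ξ′
◂ˢ-↭ Perm.refl ms = _ , ms , ↭-refl
◂ˢ-↭ (prep _ π) (m ∷ ms) with ◂ˢ-↭ π ms
... | _ , ns , ρ = _ , m ∷ ns , prep _ ρ
◂ˢ-↭ (swap _ _ π) (m ∷ m′ ∷ ms) with ◂ˢ-↭ π ms
... | _ , ns , ρ = _ , m′ ∷ m ∷ ns , swap _ _ ρ
◂ˢ-↭ (Perm.trans π₁ π₂) ms with ◂ˢ-↭ π₂ ms
... | _ , ns , ρ₂ with ◂ˢ-↭ π₁ ns
... | _ , os , ρ₁ = _ , os , ↭-trans ρ₁ ρ₂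

formula⁺ : ⟦ A ⟧ Φ → formula A ◂ᵐ Φ
formula⁺ {Φ = Φ} a =
  subst (_ ◂ᵐ_) (trans (⊗-identityˡ (Φ ⊗ ε)) (⊗-identityʳ Φ)) ([] ⨾ fm a [])

formula⁻ : formula A ◂ᵐ Φ → ⟦ A ⟧ Φ
formula⁻ {A = A} ([] ⨾ fm {Φ = Φ} a []) =
  subst ⟦ A ⟧ (sym (trans (⊗-identityˡ (Φ ⊗ ε)) (⊗-identityʳ Φ))) a

bracket⁺ : Θ ◂ᵐ Φ → bracket Θ ◂ᵐ bracket Φ
bracket⁺ m = [] ⨾ ([ m ]∷ [])

stouped⁺ : ⟦ A ⟧ (stouped B) → stouped A ◂ᵐ stouped B
stouped⁺ a = (a ∷ []) ⨾ []

◂ˢ-refl : (ζ : Stoup S) → ζ ◂ˢ ζ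
◂ˢ-refl ζ = Pointwise.refl (λ {A} → ⟦⟧-⊑ A !P-⊑ (reflect A))

mutual
  ◂-refl : (Γ : Sequence S) → Γ ◂ ([] ⨾ Γ)
  ◂-refl []          = []
  ◂-refl (fm A ∷ Γ)  = fm (reflect A) (◂-refl Γ)
  ◂-refl ([ Θ ] ∷ Γ) = [ ◂ᵐ-refl Θ ]∷ ◂-refl Γ

  ◂ᵐ-refl : (Θ : MetaFormula S) → Θ ◂ᵐ Θ
  ◂ᵐ-refl (ζ ⨾ Γ) =
    subst ((ζ ⨾ Γ) ◂ᵐ_) (cong (_⨾ Γ) (++-identityʳ ζ)) (◂ˢ-refl ζ ⨾ ◂-refl Γ)

-- Lambek's restriction

NonEmpty : (S : Calculus) → MetaFormula S → Set
NonEmpty S (ζ ⨾ Γ) = NonEmptyIfRestricted S ζ Γ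

NonEmpty⇒≢ε : {Θ : MetaFormula M′₂₀₁₈⁻} → NonEmpty M′₂₀₁₈⁻ Θ → Θ ≢ ε
NonEmpty⇒≢ε (inj₁ ne) refl = ne refl
NonEmpty⇒≢ε (inj₂ ne) refl = ne refl

≢ε⇒NonEmpty : {Θ : MetaFormula M′₂₀₁₈⁻} → Θ ≢ ε → NonEmpty M′₂₀₁₈⁻ Θ
≢ε⇒NonEmpty {[] ⨾ []}      ne = ⊥-elim (ne refl)
≢ε⇒NonEmpty {[] ⨾ (_ ∷ _)} ne = inj₁ λ ()
≢ε⇒NonEmpty {(_ ∷ _) ⨾ Γ}  ne = inj₂ λ ()

⊗-conicalˡ : (Φ Ψ : MetaFormula S) → Φ ⊗ Ψ ≡ ε → Φ ≡ ε
⊗-conicalˡ ([] ⨾ []) ([] ⨾ []) refl = refl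

⊗-conicalʳ : (Φ Ψ : MetaFormula S) → Φ ⊗ Ψ ≡ ε → Ψ ≡ ε
⊗-conicalʳ ([] ⨾ []) ([] ⨾ []) refl = refl

-- Non-emptiness of the antecedent alone is not an invariant: []⁻¹R opens a bracket, so
-- brackets have to be non-empty at every depth.
mutual
  data Full {S} : Pred S where
    _⨾_ : (ζ ⨾ Γ) ≢ ε → All FullTerm Γ → Full (ζ ⨾ Γ)

  data FullTerm {S} : TreeTerm S → Set where
    fm  : FullTerm (fm A)
    [_] : Full Θ → FullTerm [ Θ ]

Full⇒≢ε : Full Θ → Θ ≢ ε
Full⇒≢ε (ne ⨾ _) = ne

Full-⟪⟫ : (Ξ : Context S) → (Full Φ → Full Ψ) → Full (Ξ ⟪ Φ ⟫) → Full (Ξ ⟪ Ψ ⟫)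
Full-⟪⟫ ∙                  h = h
Full-⟪⟫ (within ζ Γ Ξ Δ) h (ne ⨾ fs) with All.++⁻ Γ fs
... | fs₁ , [ f ] ∷ fs₂ = occupied Γ ⨾ All.++⁺ fs₁ ([ Full-⟪⟫ Ξ h f ] ∷ fs₂)
  where
  occupied : ∀ (Γ : Sequence _) {t Δ} → (ζ ⨾ Γ ++ t ∷ Δ) ≢ ε
  occupied []      ()
  occupied (_ ∷ _) ()

insert-≢ε : (Φ : MetaFormula S) → Φ ≢ ε → insert ζ Γ₁ Γ₂ Φ ≢ ε
insert-≢ε {ζ = ζ} {Γ₁ = Γ₁} {Γ₂ = Γ₂} (ξ ⨾ Π) ne eq = ne (⊗-conicalˡ (ξ ⨾ Π) (ζ ⨾ Γ₂)
  (⊗-conicalʳ ([] ⨾ Γ₁) ((ξ ⨾ Π) ⊗ (ζ ⨾ Γ₂)) eq))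

FullTerms : Pred S
FullTerms (ζ ⨾ Γ) = All FullTerm Γ

-- Changing the filler affects the emptiness of surrounding material only at the innermost enclosing
-- level, where `Ψ ≢ ε` suffices.
Full-plug : (K : Slot S) (Φ Ψ : MetaFormula S) → Ψ ≢ ε → (FullTerms Φ → FullTerms Ψ) →
            Full (plug K Φ) → Full (plug K Ψ)
Full-plug (slot Ξ ζ Δ₁ Δ₂) (ζ₁ ⨾ Γ₁) (ζ₂ ⨾ Γ₂) ne h = Full-⟪⟫ Ξ local
  where
  local : Full (insert ζ Δ₁ Δ₂ (ζ₁ ⨾ Γ₁)) → Full (insert ζ Δ₁ Δ₂ (ζ₂ ⨾ Γ₂))
  local (_ ⨾ fs) with All.++⁻ Δ₁ fs
  ... | fs₁ , fs′ with All.++⁻ Γ₁ fs′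
  ... | fs , fs₂ =
    insert-≢ε {ζ = ζ} {Δ₁} {Δ₂} (ζ₂ ⨾ Γ₂) ne ⨾ All.++⁺ fs₁ (All.++⁺ (h fs) fs₂)

⧹L-plug : (Ξ : Context S) (ζ₁ ζ₂ : Stoup S) (Δ₁ Γ : Sequence S) (A : Formula S) (Δ₂ : Sequence S) →
          plug (slot Ξ ζ₂ Δ₁ Δ₂) (ζ₁ ⨾ Γ ++ fm A ∷ []) ≡ Ξ ⟪ ζ₁ ++ ζ₂ ⨾ Δ₁ ++ Γ ++ fm A ∷ Δ₂ ⟫
⧹L-plug Ξ ζ₁ ζ₂ Δ₁ Γ A Δ₂ =
  cong (λ Π → Ξ ⟪ ζ₁ ++ ζ₂ ⨾ Δ₁ ++ Π ⟫) (++-assoc Γ (fm A ∷ []) Δ₂)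

-- The right rules for implications and `!C′` could empty an antecedent or a bracket, but carry the
-- side condition; for `[]⁻¹R` the claim is read off inside the bracket. With `reify`, this keeps
-- `ε` out of every denotation.
⊢⇒Full : {Θ : MetaFormula M′₂₀₁₈⁻} {C : Formula M′₂₀₁₈⁻} → Θ ⊢ C → Full Θ
⊢⇒Full (perm Ξ π d) = Full-⟪⟫ Ξ
  (λ { (ne ⨾ fs) → (λ { refl → ne (cong (_⨾ []) (↭-empty-inv π)) }) ⨾ fs }) (⊢⇒Full d)
⊢⇒Full ax = (λ ()) ⨾ (fm ∷ [])
⊢⇒Full (/L {ζ₁ = ζ₁} {Γ = Γ} {B = B} {ζ₂ = ζ} {Δ₁ = Δ₁} {C = C} {Δ₂ = Δ₂} Ξ d₁ d₂) with ⊢⇒Full d₁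
... | _ ⨾ fs = Full-plug (slot Ξ ζ Δ₁ Δ₂) (formula C) (ζ₁ ⨾ fm (C / B) ∷ Γ)
                 (λ ()) (λ _ → fm ∷ fs) (⊢⇒Full d₂)
⊢⇒Full (/R ne d) with ⊢⇒Full d
... | _ ⨾ fs = NonEmpty⇒≢ε ne ⨾ All.++⁻ˡ _ fs
⊢⇒Full (⧹L {ζ₁ = ζ₁} {Γ = Γ} {A = A} {ζ₂ = ζ} {Δ₁ = Δ₁} {C = C} {Δ₂ = Δ₂} Ξ d₁ d₂) with ⊢⇒Full d₁
... | ne ⨾ fs = subst Full (⧹L-plug Ξ ζ₁ ζ Δ₁ Γ (A ⧹ C) Δ₂)
  (Full-plug (slot Ξ ζ Δ₁ Δ₂) (formula C) (ζ₁ ⨾ Γ ++ fm (A ⧹ C) ∷ [])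
    (ne ∘ ⊗-conicalˡ (ζ₁ ⨾ Γ) (formula (A ⧹ C)) ∘ trans (cong (_⨾ _) (++-identityʳ ζ₁)))
    (λ _ → All.++⁺ fs (fm ∷ [])) (⊢⇒Full d₂))
⊢⇒Full (⧹R ne d) with ⊢⇒Full d
... | _ ⨾ (_ ∷ fs) = NonEmpty⇒≢ε ne ⨾ fs
⊢⇒Full (·L {ζ = ζ} {Δ₁ = Δ₁} {A = A} {B = B} {Δ₂ = Δ₂} Ξ d) =
  Full-plug (slot Ξ ζ Δ₁ Δ₂) (formula A ⊗ formula B) (formula (A · B))
    (λ ()) (λ _ → fm ∷ []) (⊢⇒Full d)
⊢⇒Full (·R d₁ d₂) with ⊢⇒Full d₁ | ⊢⇒Full d₂
... | ne ⨾ fs₁ | _ ⨾ fs₂ = (ne ∘ ⊗-conicalˡ (_ ⨾ _) (_ ⨾ _)) ⨾ All.++⁺ fs₁ fs₂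
⊢⇒Full (∨L {ζ = ζ} {Δ₁ = Δ₁} {A₁ = A₁} {Δ₂ = Δ₂} {A₂ = A₂} Ξ d₁ d₂) =
  Full-plug (slot Ξ ζ Δ₁ Δ₂) (formula A₁) (formula (A₁ ∨ A₂)) (λ ()) (λ _ → fm ∷ []) (⊢⇒Full d₁)
⊢⇒Full (∨R₁ d) = ⊢⇒Full d
⊢⇒Full (∨R₂ d) = ⊢⇒Full d
⊢⇒Full (∧L₁ {ζ = ζ} {Δ₁ = Δ₁} {A₁ = A₁} {Δ₂ = Δ₂} {A₂ = A₂} Ξ d) =
  Full-plug (slot Ξ ζ Δ₁ Δ₂) (formula A₁) (formula (A₁ ∧ A₂)) (λ ()) (λ _ → fm ∷ []) (⊢⇒Full d)
⊢⇒Full (∧L₂ {ζ = ζ} {Δ₁ = Δ₁} {A₂ = A₂} {Δ₂ = Δ₂} {A₁ = A₁} Ξ d) =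
  Full-plug (slot Ξ ζ Δ₁ Δ₂) (formula A₂) (formula (A₁ ∧ A₂)) (λ ()) (λ _ → fm ∷ []) (⊢⇒Full d)
⊢⇒Full (∧R d₁ d₂) = ⊢⇒Full d₁
⊢⇒Full ([]⁻¹L {ζ = ζ} {Δ₁ = Δ₁} {A = A} {Δ₂ = Δ₂} Ξ d) =
  Full-plug (slot Ξ ζ Δ₁ Δ₂) (formula A) (bracket (formula ([]⁻¹ A)))
    (λ ()) (λ _ → [ (λ ()) ⨾ (fm ∷ []) ] ∷ []) (⊢⇒Full d)
⊢⇒Full ([]⁻¹R d) with ⊢⇒Full d
... | _ ⨾ ([ f ] ∷ []) = f
⊢⇒Full (⟨⟩L {ζ = ζ} {Δ₁ = Δ₁} {A = A} {Δ₂ = Δ₂} Ξ d) =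
  Full-plug (slot Ξ ζ Δ₁ Δ₂) (bracket (formula A)) (formula (⟨⟩ A))
    (λ ()) (λ _ → fm ∷ []) (⊢⇒Full d)
⊢⇒Full (⟨⟩R d) = (λ ()) ⨾ ([ ⊢⇒Full d ] ∷ [])
⊢⇒Full (!L {A = A} {ζ = ζ} {Γ₁ = Γ₁} {Γ₂ = Γ₂} Ξ d) =
  Full-plug (slot Ξ ζ Γ₁ Γ₂) (stouped A) (formula (! A)) (λ ()) (λ _ → fm ∷ []) (⊢⇒Full d)
⊢⇒Full (!P {ζ = ζ} {Γ₁ = Γ₁} {A = A} {Γ₂ = Γ₂} Ξ d) =
  Full-plug (slot Ξ ζ Γ₁ Γ₂) (formula A) (stouped A) (λ ()) (λ _ → []) (⊢⇒Full d)
⊢⇒Full (!R′ d) = (λ ()) ⨾ []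
⊢⇒Full (!C′ {ζ′ = ζ′} {Γ₂ = Γ} {A = A} {ζ = ζ} {Γ₁ = Δ₁} {Γ₃ = Δ₂} Ξ ne d) =
  Full-plug (slot Ξ ζ Δ₁ Δ₂)
    (stouped A ⊗ bracket (A ∷ ζ′ ⨾ Γ)) (stouped A ⊗ bracket (bracket (ζ′ ⨾ Γ)))
    -- The inner stoup loses its copy of `A`; the side condition keeps that bracket occupied.
    (λ ()) (λ { ([ _ ⨾ fs ] ∷ []) → [ (λ ()) ⨾ ([ NonEmpty⇒≢ε ne ⨾ fs ] ∷ []) ] ∷ [] })
    (⊢⇒Full d)

◂-ε⁻ : {Γ : Sequence M′₂₀₁₈⁻} → Γ ◂ Φ → Φ ≡ ε → Γ ≡ []
◂-ε⁻ [] eq = refl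
◂-ε⁻ (fm {A = A} {Φ = Φ} {Ψ = Ψ} a m) eq =
  ⊥-elim (Full⇒≢ε (⊢⇒Full (reify A a)) (⊗-conicalˡ Φ Ψ eq))
◂-ε⁻ ([_]∷_ {Φ = Φ} {Ψ = Ψ} b m) eq with ⊗-conicalˡ (bracket Φ) Ψ eq
... | ()

◂ᵐ-ε⁻ : {Θ : MetaFormula M′₂₀₁₈⁻} → Θ ◂ᵐ Φ → Φ ≡ ε → Θ ≡ ε
◂ᵐ-ε⁻ (_⨾_ {ζ′ = ζ′} {Ψ = Ψ} ms m) eq
  with ⊗-conicalˡ (ζ′ ⨾ []) Ψ eq | ms | ◂-ε⁻ m (⊗-conicalʳ (ζ′ ⨾ []) Ψ eq)
... | refl | [] | refl = refl

-- This carries the side conditions of the implication right rules and of `!C′` over to instances.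
NonEmpty-◂ᵐ : NonEmpty S Θ → Θ ◂ᵐ Φ → NonEmpty S Φ
NonEmpty-◂ᵐ {S = M′₂₀₁₈} {Φ = ζ ⨾ Γ} ne m = tt
NonEmpty-◂ᵐ {S = M′₂₀₁₈⁻} ne m = ≢ε⇒NonEmpty (NonEmpty⇒≢ε ne ∘ ◂ᵐ-ε⁻ m)

-- Soundness

-- Decomposing instances rather than sequents avoids comparing the positions of two
-- designated occurrences, since only the principal formula of a rule is designated.
record Focus {S} (p : MetaFormula S → MetaFormula S) (Φ Θ′ : MetaFormula S) : Set where
  field
    frame     : MetaFormula S → MetaFormula S
    framelike : Framelike frame
    filler    : MetaFormula S
    instance◂ : Φ ◂ᵐ filler
    below     : frame filler ⊑ Θ′
    refill    : Ψ ◂ᵐ Ψ′ → ∃ λ Ω → p Ψ ◂ᵐ Ω × Ω ⊑ frame Ψ′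
open Focus

Transparent : (MetaFormula S → MetaFormula S) → Set
Transparent p = ∀ {Φ Θ′} → p Φ ◂ᵐ Θ′ → Focus p Φ Θ′

Transparent-∘ : Transparent p → Transparent q → Transparent (p ∘ q)
Transparent-∘ tp tq m = record
  { frame     = frame F ∘ frame G
  ; framelike = Framelike-∘ (framelike F) (framelike G)
  ; filler    = filler G
  ; instance◂ = instance◂ G
  ; below     = ⊑-trans (Framelike-mono (framelike F) (below G)) (below F)
  ; refill    = λ n → let _ , n₁ , le₁ = refill G n
                          _ , n₂ , le₂ = refill F n₁
                      in _ , n₂ , ⊑-trans le₂ (Framelike-mono (framelike F) le₁)
  }
  where
  F = tp m
  G = tq (instance◂ F)

Transparent-within : (ζ : Stoup S) (Γ Δ : Sequence S) →
                     Transparent (λ Θ → ζ ⨾ Γ ++ [ Θ ] ∷ Δ)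
Transparent-within ζ Γ Δ (_⨾_ {ζ′ = ζ′} ms m) with ◂-++⁻ Γ m
... | split {Φ = Φ₁} m₁ ([_]∷_ {Φ = Φ} {Ψ = Φ₂} b m₂) = record
  { frame     = λ Θ → (ζ′ ⨾ []) ⊗ Φ₁ ⊗ bracket Θ ⊗ Φ₂
  ; framelike = Framelike-∘ (Framelike-⊗ˡ _) (Framelike-∘ (Framelike-⊗ˡ Φ₁)
                  (Framelike-∘ (Framelike-⊗ʳ Φ₂) Framelike-bracket))
  ; filler    = Φ
  ; instance◂ = b
  ; below     = ⊑-refl
  ; refill    = λ n → _ , (ms ⨾ ◂-++⁺ m₁ ([ n ]∷ m₂)) , ⊑-refl
  }

Transparent-⟪⟫ : (Ξ : Context S) → Transparent (Ξ ⟪_⟫)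
Transparent-⟪⟫ ∙ m = record
  { frame = id ; framelike = Framelike-id ; filler = _ ; instance◂ = m
  ; below = ⊑-refl ; refill = λ n → _ , n , ⊑-refl }
Transparent-⟪⟫ (within ζ Γ Ξ Δ) = Transparent-∘ (Transparent-within ζ Γ Δ) (Transparent-⟪⟫ Ξ)

insert-↭ : (ζ ξ θ₁ θ₂ θ₃ : Stoup S) →
           ζ ++ θ₁ ++ (ξ ++ θ₂) ++ θ₃ ↭ (ξ ++ ζ) ++ θ₁ ++ θ₂ ++ θ₃
insert-↭ ζ ξ θ₁ θ₂ θ₃ = begin
  ζ ++ θ₁ ++ (ξ ++ θ₂) ++ θ₃ ≡⟨ cong (λ θ → ζ ++ θ₁ ++ θ) (++-assoc ξ θ₂ θ₃) ⟩
  ζ ++ θ₁ ++ ξ ++ θ₂ ++ θ₃   ↭⟨ ++⁺ˡ ζ (shifts θ₁ ξ) ⟩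
  ζ ++ ξ ++ θ₁ ++ θ₂ ++ θ₃   ↭⟨ shifts ζ ξ ⟩
  ξ ++ ζ ++ θ₁ ++ θ₂ ++ θ₃   ≡⟨ ++-assoc ξ ζ _ ⟨
  (ξ ++ ζ) ++ θ₁ ++ θ₂ ++ θ₃ ∎
  where open PermutationReasoning

-- The pieces of the instance not arising from the filler form the frame. Stoups released by the
-- sequences land in different places on reassembly, hence agreement up to `insert-↭`.
Transparent-insert : (ζ : Stoup S) (Γ₁ Γ₂ : Sequence S) → Transparent (insert ζ Γ₁ Γ₂)
Transparent-insert ζ Γ₁ Γ₂ {ξ ⨾ Π} (ms ⨾ m) with ◂ˢ-++⁻ ξ ms | ◂-++⁻ Γ₁ m
... | split {ξ₁ = ξ′} {ξ₂ = ζ′} ms₁ ms₂ | split {Φ = Φ₁@(θ₁ ⨾ _)} m₁ m′ with ◂-++⁻ Π m′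
... | split {Φ = Φ₂@(θ₂ ⨾ _)} {Ψ = Φ₃@(θ₃ ⨾ _)} m₂ m₃ = record
  { frame     = λ Θ → (ζ′ ⨾ []) ⊗ Φ₁ ⊗ Θ ⊗ Φ₃
  ; framelike = Framelike-∘ (Framelike-⊗ˡ _)
                  (Framelike-∘ (Framelike-⊗ˡ Φ₁) (Framelike-⊗ʳ Φ₃))
  ; filler    = (ξ′ ⨾ []) ⊗ Φ₂
  ; instance◂ = ms₁ ⨾ m₂
  ; below     = ↭⇒⊑ (insert-↭ ζ′ ξ′ θ₁ θ₂ θ₃)
  ; refill    = λ { (_⨾_ {ζ′ = ω} {Ψ = θ ⨾ _} ns n) →
                    _ , (Pointwise.++⁺ ns ms₂ ⨾ ◂-++⁺ m₁ (◂-++⁺ n m₃)) ,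
                    ↭⇒⊑ (↭-sym (insert-↭ ζ′ ω θ₁ θ θ₃)) }
  }

Transparent-plug : (K : Slot S) → Transparent (plug K)
Transparent-plug (slot Ξ ζ Γ₁ Γ₂) = Transparent-∘ (Transparent-⟪⟫ Ξ) (Transparent-insert ζ Γ₁ Γ₂)

-- `Ψ` may vary with the element, so that `∨L` can choose its premise separately for each generator.
Fill : (MetaFormula S → MetaFormula S) → Pred S → Pred S
Fill p Y Ψ′ = ∃ λ Ψ → Ψ ◂ᵐ Ψ′ × (∀ {Θ} → p Ψ ◂ᵐ Θ → Y Θ)

-- This reduces a left rule to its active part: `Cl-frame` lifts the local closure statement through
-- the frame, and closedness of `Y` discharges the closure.
fill : Transparent p → Closed Y → (∀ {Φ′} → Φ ◂ᵐ Φ′ → Cl (Fill p Y) Φ′) → p Φ ◂ᵐ Θ → Y Θ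
fill tp cl h m = Closed-⊑ cl (below F) (cl (Cl-frame (framelike F) refilled (h (instance◂ F))))
  where
  F = tp m
  refilled : ∀ {Ψ′} → Fill _ _ Ψ′ → Cl _ (frame F Ψ′)
  refilled (Ψ , n , k) with refill F n
  ... | _ , n′ , le = η (Closed-⊑ cl le (k n′))

sound : {C : Formula S} → Θ ⊢ C → Θ ◂ᵐ Θ′ → ⟦ C ⟧ Θ′
soundL : {C : Formula S} (K : Slot S) (Φ Ψ : MetaFormula S) → plug K Ψ ⊢ C →
         (∀ {Φ′} → Φ ◂ᵐ Φ′ → Cl (Ψ ◂ᵐ_) Φ′) → plug K Φ ◂ᵐ Θ → ⟦ C ⟧ Θ
soundL {C = C} K Φ Ψ d h =
  fill (Transparent-plug K) (⟦⟧-closed C) (Cl-bind (λ n → η (Ψ , n , sound d)) ∘ h)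

sound {C = C} (perm {ζ = ζ} {Γ = Γ} Ξ π d) = fill (Transparent-⟪⟫ Ξ) (⟦⟧-closed C) λ
  { (_⨾_ {Ψ = _ ⨾ _} ms m) → let _ , ns , ρ = ◂ˢ-↭ π ms in
    mkCl λ K h → transport (↭⇒⊑ (++⁺ʳ _ ρ)) K (h ((ζ ⨾ Γ) , (ns ⨾ m) , sound d)) }
sound ax = formula⁻
sound 𝟏R ([] ⨾ []) = η refl
sound (𝟏L {ζ = ζ} {Δ₁ = Δ₁} {Δ₂ = Δ₂} Ξ d) = soundL (slot Ξ ζ Δ₁ Δ₂) (formula 𝟏) ε d
  (Cl-bind (λ { refl → η ([] ⨾ []) }) ∘ formula⁻)
sound (/L {ζ₁ = ζ₁} {Γ = Γ} {B = B} {ζ₂ = ζ} {Δ₁ = Δ₁} {C = C} {Δ₂ = Δ₂} Ξ d₁ d₂) =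
  soundL (slot Ξ ζ Δ₁ Δ₂) (ζ₁ ⨾ fm (C / B) ∷ Γ) (formula C) d₂
    λ { (_⨾_ {ζ′ = ζ′} ms (fm {Φ = F} {Ψ = G} f m)) →
        -- The instance has its stoup to the left of `F`, while `f` multiplies everything on the
        -- right of `F`.
        η (formula⁺ (⟦⟧-⊑ C (stoup-unshift ζ′ F G) (proj₂ f (sound d₁ (ms ⨾ m))))) }
sound (/R {ζ = ζ} {Γ = Γ} {B = B} {C = C} ne d) m@(_⨾_ {ζ′ = ζ′} {Ψ = G} ms n) =
  curried , apply
  where
  apply : ∀ {Φ} → ⟦ B ⟧ Φ → ⟦ C ⟧ (((ζ′ ⨾ []) ⊗ G) ⊗ Φ)
  apply {Φ} b = subst ⟦ C ⟧
    (trans (cong (λ Ψ → (ζ′ ⨾ []) ⊗ G ⊗ Ψ) (⊗-identityʳ Φ)) (sym (⊗-assoc (ζ′ ⨾ []) G Φ)))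
    (sound d (ms ⨾ ◂-++⁺ n (fm b [])))
  -- Feeding in `B` itself by `reflect` and reifying the result yields the premise of `/R`.
  curried : ((ζ′ ⨾ []) ⊗ G) ⊢ C / B
  curried with (ζ′ ⨾ []) ⊗ G | NonEmpty-◂ᵐ {Θ = ζ ⨾ Γ} ne m | reify C (apply (reflect B))
  ... | ξ ⨾ Π | ne′ | d′ = /R ne′ (perm ∙ (↭-reflexive (++-identityʳ ξ)) d′)
sound (⧹L {ζ₁ = ζ₁} {Γ = Γ} {A = A} {ζ₂ = ζ} {Δ₁ = Δ₁} {C = C} {Δ₂ = Δ₂} Ξ d₁ d₂) =
  soundL (slot Ξ ζ Δ₁ Δ₂) (ζ₁ ⨾ Γ ++ fm (A ⧹ C) ∷ []) (formula C) d₂ local ∘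
  subst (_◂ᵐ _) (sym (⧹L-plug Ξ ζ₁ ζ Δ₁ Γ (A ⧹ C) Δ₂))
  where
  local : ∀ {Φ′} → ζ₁ ⨾ Γ ++ fm (A ⧹ C) ∷ [] ◂ᵐ Φ′ → Cl (formula C ◂ᵐ_) Φ′
  local (_⨾_ {ζ′ = ζ′} ms m) with ◂-++⁻ Γ m
  ... | split {Φ = G} m₁ (fm {Φ = F} f []) = η (formula⁺ (subst ⟦ C ⟧
    (trans (⊗-assoc (ζ′ ⨾ []) G F) (cong (λ Ψ → (ζ′ ⨾ []) ⊗ G ⊗ Ψ) (sym (⊗-identityʳ F))))
    (proj₂ f (sound d₁ (ms ⨾ m₁)))))
sound (⧹R {ζ = ζ} {Γ = Γ} {A = A} {C = C} ne d) m@(_⨾_ {ζ′ = ζ′} {Ψ = G} ms n) =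
  curried , apply
  where
  apply : ∀ {Φ} → ⟦ A ⟧ Φ → ⟦ C ⟧ (Φ ⊗ (ζ′ ⨾ []) ⊗ G)
  apply {Φ} a = ⟦⟧-⊑ C (stoup-shift ζ′ Φ G) (sound d (ms ⨾ fm a n))
  curried : ((ζ′ ⨾ []) ⊗ G) ⊢ A ⧹ C
  curried with (ζ′ ⨾ []) ⊗ G | NonEmpty-◂ᵐ {Θ = ζ ⨾ Γ} ne m | reify C (apply (reflect A))
  ... | ξ ⨾ Π | ne′ | d′ = ⧹R ne′ d′
sound (·L {ζ = ζ} {Δ₁ = Δ₁} {A = A} {B = B} {Δ₂ = Δ₂} Ξ d) =
  soundL (slot Ξ ζ Δ₁ Δ₂) (formula (A · B)) (formula A ⊗ formula B) d
    (Cl-bind (λ { (_,_ {Φ = Φ} {Ψ = Ψ} a b) → η (subst (_ ◂ᵐ_)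
      (trans (⊗-identityˡ _) (cong (Φ ⊗_) (⊗-identityʳ Ψ))) ([] ⨾ fm a (fm b []))) }) ∘ formula⁻)
sound (·R {ζ₁ = ζ₁} {Δ = Δ} d₁ d₂) (ms ⨾ m) with ◂ˢ-++⁻ ζ₁ ms | ◂-++⁻ Δ m
... | split {ξ₁ = ξ₁} {ξ₂} ms₁ ms₂ | split {Φ = φ₁ ⨾ _} {Ψ = φ₂ ⨾ _} m₁ m₂ =
  Closed-⊑ Cl-closed (↭⇒⊑ interchange) (η (sound d₁ (ms₁ ⨾ m₁) , sound d₂ (ms₂ ⨾ m₂)))
  where
  open PermutationReasoning
  interchange : (ξ₁ ++ φ₁) ++ ξ₂ ++ φ₂ ↭ (ξ₁ ++ ξ₂) ++ φ₁ ++ φ₂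
  interchange = begin
    (ξ₁ ++ φ₁) ++ ξ₂ ++ φ₂ ≡⟨ ++-assoc ξ₁ φ₁ _ ⟩
    ξ₁ ++ φ₁ ++ ξ₂ ++ φ₂   ↭⟨ ++⁺ˡ ξ₁ (shifts φ₁ ξ₂) ⟩
    ξ₁ ++ ξ₂ ++ φ₁ ++ φ₂   ≡⟨ ++-assoc ξ₁ ξ₂ _ ⟨
    (ξ₁ ++ ξ₂) ++ φ₁ ++ φ₂ ∎
sound {C = C} (∨L {ζ = ζ} {Δ₁ = Δ₁} {A₁ = A₁} {Δ₂ = Δ₂} {A₂ = A₂} Ξ d₁ d₂) =
  fill (Transparent-plug (slot Ξ ζ Δ₁ Δ₂)) (⟦⟧-closed C) (Cl-bind (λ
    { (inj₁ a) → η (formula A₁ , formula⁺ a , sound d₁)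
    ; (inj₂ a) → η (formula A₂ , formula⁺ a , sound d₂) }) ∘ formula⁻ {A = A₁ ∨ A₂})
sound (∨R₁ d) m = η (inj₁ (sound d m))
sound (∨R₂ d) m = η (inj₂ (sound d m))
sound (∧L₁ {ζ = ζ} {Δ₁ = Δ₁} {A₁ = A₁} {Δ₂ = Δ₂} {A₂ = A₂} Ξ d) =
  soundL (slot Ξ ζ Δ₁ Δ₂) (formula (A₁ ∧ A₂)) (formula A₁) d (η ∘ formula⁺ ∘ proj₁ ∘ formula⁻)
sound (∧L₂ {ζ = ζ} {Δ₁ = Δ₁} {A₂ = A₂} {Δ₂ = Δ₂} {A₁ = A₁} Ξ d) =
  soundL (slot Ξ ζ Δ₁ Δ₂) (formula (A₁ ∧ A₂)) (formula A₂) d (η ∘ formula⁺ ∘ proj₂ ∘ formula⁻)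
sound (∧R d₁ d₂) m = sound d₁ m , sound d₂ m
sound ([]⁻¹L {ζ = ζ} {Δ₁ = Δ₁} {A = A} {Δ₂ = Δ₂} Ξ d) =
  soundL (slot Ξ ζ Δ₁ Δ₂) (bracket (formula ([]⁻¹ A))) (formula A) d
    -- Membership in `⟦ []⁻¹ A ⟧` already says that the bracketed filler lies in `⟦ A ⟧`.
    λ { ([] ⨾ ([ m ]∷ [])) → η (formula⁺ (formula⁻ m)) }
sound ([]⁻¹R d) m = sound d (bracket⁺ m)
sound (⟨⟩L {ζ = ζ} {Δ₁ = Δ₁} {A = A} {Δ₂ = Δ₂} Ξ d) =
  soundL (slot Ξ ζ Δ₁ Δ₂) (formula (⟨⟩ A)) (bracket (formula A)) d
    (Cl-bind (λ { (bracketᴾ a) → η (bracket⁺ (formula⁺ a)) }) ∘ formula⁻)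
sound (⟨⟩R d) ([] ⨾ ([ m ]∷ [])) = η (bracketᴾ (sound d m))
sound (!L {A = A} {ζ = ζ} {Γ₁ = Γ₁} {Γ₂ = Γ₂} Ξ d) =
  soundL (slot Ξ ζ Γ₁ Γ₂) (formula (! A)) (stouped A) d
    (Cl-bind (λ { (stoupedᴾ a) → η (stouped⁺ a) }) ∘ formula⁻)
sound (!P {ζ = ζ} {Γ₁ = Γ₁} {A = A} {Γ₂ = Γ₂} Ξ d) =
  soundL (slot Ξ ζ Γ₁ Γ₂) (stouped A) (formula A) d λ { ((a ∷ []) ⨾ []) → η (formula⁺ a) }
sound (!R′ d) m@((_ ∷ []) ⨾ []) = η (stoupedᴾ (sound d m))
sound (!C′ {ζ′ = ζ′} {Γ₂ = Γ} {A = A} {ζ = ζ} {Γ₁ = Δ₁} {Γ₃ = Δ₂} Ξ ne d) =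
  soundL (slot Ξ ζ Δ₁ Δ₂)
    (stouped A ⊗ bracket (bracket (ζ′ ⨾ Γ))) (stouped A ⊗ bracket (A ∷ ζ′ ⨾ Γ)) d
    λ { ((a ∷ []) ⨾ ([ [] ⨾ ([ m@(_⨾_ {Ψ = _ ⨾ _} ms n) ]∷ []) ]∷ [])) →
        -- The syntactic `!C′` contracts the formula substituted for `A`; its witness `a` serves for
        -- both copies.
        mkCl λ { (slot Ω _ _ _) h →
          !C′ Ω (NonEmpty-◂ᵐ {Θ = ζ′ ⨾ Γ} ne m) (h ((a ∷ []) ⨾ ([ (a ∷ ms) ⨾ n ]∷ []))) } }

-- Cut from soundness

◂ᵐ-⟪⟫ : (Ξ : Context S) → Φ ◂ᵐ Ψ → Ξ ⟪ Φ ⟫ ◂ᵐ Ξ ⟪ Ψ ⟫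
◂ᵐ-⟪⟫ ∙ m = m
◂ᵐ-⟪⟫ (within ζ Γ Ξ Δ) m =
  subst (_◂ᵐ_ (ζ ⨾ Γ ++ [ Ξ ⟪ _ ⟫ ] ∷ Δ)) (cong (_⨾ _) (++-identityʳ ζ))
    (◂ˢ-refl ζ ⨾ ◂-++⁺ (◂-refl Γ) ([ ◂ᵐ-⟪⟫ Ξ m ]∷ ◂-refl Δ))

theorem1 : (S : Calculus) (ξ ζ : Stoup S) (Π Γ₁ Γ₂ : Sequence S) (A C : Formula S)
    (Ξ : Context S) →
    ξ ⨾ Π ⊢ A →
    Ξ ⟪ ζ ⨾ Γ₁ ++ fm A ∷ Γ₂ ⟫ ⊢ C →
    Ξ ⟪ ξ ++ ζ ⨾ Γ₁ ++ Π ++ Γ₂ ⟫ ⊢ C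
theorem1 S ξ ζ Π Γ₁ Γ₂ A C Ξ d₁ d₂ =
  -- All occurrences except the cut formula are replaced by themselves; the instance then has the
  -- stoup `ζ ++ ξ ++ []`, which is permuted into place.
  perm Ξ (↭-trans (++⁺ˡ ζ (↭-reflexive (++-identityʳ ξ))) (++-comm ζ ξ))
    (reify C (sound d₂ (◂ᵐ-⟪⟫ Ξ
      (◂ˢ-refl ζ ⨾ ◂-++⁺ (◂-refl Γ₁) (fm (sound d₁ (◂ᵐ-refl (ξ ⨾ Π))) (◂-refl Γ₂))))))
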